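{- Let $\varepsilon \in (0,1]$, let $k$ be a positive integer, and let $m_1\leq m_2 \leq \cdots \leq m_k$ be positive integers such that $\varepsilon\cdot m_i\geq 2m_{i-1}^2$ for every $2\leq i\leq k$. If $n\geq (2+ \varepsilon)(m_1+ \cdots + m_k)$ and $N\geq (n-1)(k-1)+m_1$, then $K_N\rightarrow(P_n,K_{m_1,\ldots,m_k})$.
   Context: For graphs $K,G,H$, the notation $K\rightarrow(G,H)$ means that every coloring of the edges of $K$ with red and blue contains a red copy of $G$ or a blue copy of $H$. $K_N$ is the complete graph on $N$ vertices, $P_n$ is the path with $n$ vertices, and $K_{m_1,\ldots,m_k}$ is the complete $k$-partite graph with parts of sizes $m_1,\ldots,m_k$. -}

module Defs where

open import Data.Bool using (Bool; true; false)
open import Data.Nat as ℕ using (ℕ; suc)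
open import Data.Fin using (Fin; toℕ)
open import Data.Sum using (_⊎_)
open import Data.Product using (Σ; Σ-syntax; _×_; _,_)
open import Data.List using (List; tabulate)
open import Data.Nat.ListAction using (sum)
open import Data.Integer using (+_)
open import Data.Rational using (ℚ; _/_)
open import Function.Definitions using (Injective)
open import Relation.Binary.PropositionalEquality using (_≡_; _≢_)

ℕtoℚ : ℕ → ℚ
ℕtoℚ n = + n / 1

Colour : Set
Colour = Bool

red blue : Colour
red  = true
blue = false

-- A red/blue colouring of the edges of K_N: a symmetric map on pairs of
-- vertices (values on the diagonal x = y are irrelevant, not edges).
record EdgeColouring (N : ℕ) : Set where
  field
    col  : Fin N → Fin N → Colour
    symm : ∀ x y → col x y ≡ col y x
open EdgeColouring public

HasRedPath : ∀ {N} → EdgeColouring N → ℕ → Set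
HasRedPath {N} c n =
  Σ[ f ∈ (Fin n → Fin N) ] Injective _≡_ _≡_ f ×
    (∀ (i j : Fin n) → toℕ j ≡ suc (toℕ i) → col c (f i) (f j) ≡ red)

MPVertex : ∀ {k} → (Fin k → ℕ) → Set
MPVertex {k} m = Σ[ i ∈ Fin k ] Fin (m i)

HasBlueMultipartite : ∀ {N k} → EdgeColouring N → (Fin k → ℕ) → Set
HasBlueMultipartite {N} {k} c m =
  Σ[ g ∈ (MPVertex m → Fin N) ] Injective _≡_ _≡_ g ×
    (∀ (i i' : Fin k) (a : Fin (m i)) (b : Fin (m i')) → i ≢ i' →
       col c (g (i , a)) (g (i' , b)) ≡ blue)

Arrows : ℕ → ℕ → ∀ {k} → (Fin k → ℕ) → Set
Arrows N n m = (c : EdgeColouring N) → HasRedPath c n ⊎ HasBlueMultipartite c m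

sumParts : ∀ {k} → (Fin k → ℕ) → ℕ
sumParts m = sum (tabulate m)

{-# OPTIONS --safe #-}
module Submission where

-- Let l be the length of a longest red path P, put M = m₁ + ⋯ + m_{k-1}, and let T be a blue
-- K_{m₁,…,m_{k-1}} outside P.  If x, y are consecutive on P with x ~ t and y ~ t′ in red for t, t′ in T,
-- then t ≠ t′, and the ordered pair (t, t′) occurs only once this way, as otherwise
-- … x t (the segment between, reversed) t′ y′ … would be longer than P.  So all but about
-- (l + M (M - 1)) / 2 vertices of P have no red neighbour in T, and M (M - 1) < ε (m₁ + ⋯ + m_k) by the
-- growth of the mᵢ.  Hence T can be completed if l is close to n - 1, and T exists by induction on k.
-- In general put e = n - 1 - l.  If 2 l ≤ n - 1, depth-first search finds the blue K_{m₁,…,m_k}.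
-- Otherwise remove disjoint longest red paths with more than e / 2 vertices one after the other.  If there
-- are k - 1 of them besides P, the parts of T can be taken as their initial segments, which have no red
-- edges to the first and last e / 2 - M vertices of P.  If not, the remainder has at least (k - 1) e
-- vertices and only short red paths, so depth-first search finds T there together with about e / 2 - M
-- further vertices joined to T in blue.

open import Defs
import Algebra.Solver.CommutativeMonoid as CommutativeMonoidSolver
import Data.Bool.Properties as Bool
open import Data.Fin using (Fin; zero; suc; toℕ; fromℕ; fromℕ<; inject₁; inject≤; opposite; cast; combine; punchOut)
open import Data.Fin.Properties using (any?; combine-injective; punchOut-injective; injective⇒≤; toℕ-inject≤; inject≤-injective; opposite-prop; opposite-involutive; cast-involutive; toℕ<n)
import Data.Integer as ℤ
import Data.Integer.Properties as ℤ
open import Data.List using (List; []; _∷_; _++_; [_]; length; lookup; removeAt; take; drop; reverse; _ʳ++_; tabulate; allFin)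
open import Data.List.Membership.Propositional using (_∈_)
open import Data.List.Membership.Propositional.Properties using (∈-lookup)
open import Data.List.Properties using (length-++; length-take; take++drop≡id; length-ʳ++; length-reverse; length-tabulate)
import Data.List.Properties as List
open import Data.List.Relation.Binary.Permutation.Propositional using (_↭_; ↭-refl; ↭-prep; ↭-swap; ↭-sym; ↭-trans; ↭-reflexive; ↭⇒↭ₛ)
open import Data.List.Relation.Binary.Permutation.Propositional.Properties
import Data.List.Relation.Binary.Permutation.Setoid.Properties as Permutation
open import Data.List.Relation.Unary.All as All using (All; []; _∷_)
import Data.List.Relation.Unary.All.Properties as All
open import Data.List.Relation.Unary.AllPairs using ([]; _∷_)
open import Data.List.Relation.Unary.Any using (here; index)
open import Data.List.Relation.Unary.Any.Properties using (lookup-index)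
open import Data.List.Relation.Unary.Linked using (Linked; []; [-]; _∷_)
open import Data.List.Relation.Unary.Unique.Propositional using (Unique)
open import Data.List.Relation.Unary.Unique.Propositional.Properties using (allFin⁺)
open import Data.Nat using (ℕ; zero; suc; pred; _+_; _*_; _∸_; _≤_; _<_; z≤n; s≤s; _≤?_; _≟_; ⌊_/2⌋; ⌈_/2⌉)
import Data.Nat.Coprimality as Coprime
open import Data.Nat.ListAction using (sum)
open import Data.Nat.Properties
open import Data.Nat.Tactic.RingSolver using (solve-∀)
open import Data.Product using (∃; ∃₂; _×_; _,_; proj₁; proj₂)
open import Data.Rational as ℚ using (ℚ; 0ℚ; 1ℚ; mkℚ)
import Data.Rational.Properties as ℚ
open import Data.Sum using (_⊎_; inj₁; inj₂)
open import Function using (_∘_)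
open import Function.Definitions using (Injective)
open import Relation.Binary.Definitions using (Decidable; Symmetric)
open import Relation.Binary.PropositionalEquality using (_≡_; _≢_; refl; sym; trans; cong; cong₂; subst; subst₂; setoid)
open import Relation.Nullary using (¬_; Dec; yes; no; contradiction)
open import Relation.Nullary.Decidable using (map′)

-- Linear arithmetic: to get a ≤ b from hypotheses summing up to L ≤ R, exhibit the slack s.
by-slack : ∀ {L R a b} s → L ≤ R → a + R + s ≡ b + L → a ≤ b
by-slack {L} {R} {a} {b} s L≤R eq = +-cancelʳ-≤ L a b (begin
  a + L      ≤⟨ +-monoʳ-≤ a L≤R ⟩
  a + R      ≤⟨ m≤m+n (a + R) s ⟩
  a + R + s  ≡⟨ eq ⟩
  b + L      ∎)
  where open ≤-Reasoning

-- Duplicate-free lists and the number of off-diagonal pairs.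

Unique-lookup-injective : ∀ {A : Set} {L : List A} → Unique L → ∀ {i j} → lookup L i ≡ lookup L j → i ≡ j
Unique-lookup-injective (_ ∷ _) {zero} {zero}  _  = refl
Unique-lookup-injective {L = x ∷ L} (x∉ ∷ _) {zero} {suc j} eq = contradiction eq (All.lookup x∉ (∈-lookup j))
Unique-lookup-injective u@(_ ∷ _) {suc i} {zero} eq = sym (Unique-lookup-injective u (sym eq))
Unique-lookup-injective (_ ∷ u)  {suc i} {suc j} eq = cong suc (Unique-lookup-injective u eq)

encode : ∀ {n} {i j : Fin n} → i ≢ j → Fin (n * pred n)
encode {suc n} {i} i≢j = combine i (punchOut i≢j)

encode-injective : ∀ {n} {i j i′ j′ : Fin n} (i≢j : i ≢ j) (i′≢j′ : i′ ≢ j′) →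
                   encode i≢j ≡ encode i′≢j′ → (i , j) ≡ (i′ , j′)
encode-injective {suc n} {i} {i′ = i′} i≢j i′≢j′ eq
  with combine-injective i (punchOut i≢j) i′ (punchOut i′≢j′) eq
... | refl , eq′ = cong (i ,_) (punchOut-injective i≢j i′≢j′ eq′)

-- Transitions on a longest path are indexed by pairs of distinct positions in T, so this caps their
-- number by M (M - 1).
off-diagonal-≤ : ∀ {n} (L : List (Fin n × Fin n)) → Unique L → All (λ (i , j) → i ≢ j) L →
                 length L ≤ n * pred n
off-diagonal-≤ L unique off = injective⇒≤ {f = λ a → encode (distinct a)} λ {a} {b} eq →
  Unique-lookup-injective unique (encode-injective (distinct a) (distinct b) eq)
  where
  distinct : ∀ a → proj₁ (lookup L a) ≢ proj₂ (lookup L a)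
  distinct a = All.lookup off (∈-lookup a)

-- Parts are listed in decreasing order, so that the induction splits off the largest one and
-- lastPart is the paper's m₁.
lastPart : ℕ → List ℕ → ℕ
lastPart m []        = m
lastPart m (m′ ∷ ms) = lastPart m′ ms

-- The 1 comes from the excess in `Balance`; parity absorbs it.
halve-≤ : ∀ {a b} → 2 * a ≤ 2 * b + 1 → a ≤ b
halve-≤ {a} {b} le = ≤-pred (*-cancelˡ-< 2 a (suc b)
  (≤-trans (s≤s le) (≤-reflexive (eq b))))
  where
  eq : ∀ b → suc (2 * b + 1) ≡ 2 * suc b
  eq = solve-∀

-- Sub-multisets of a list, up to permutation.

module _ {A : Set} where

  infix 4 _⊑_

  -- The complement S is part of the data, so that disjoint pieces of V can be recombined by
  -- permutations.
  _⊑_ : List A → List A → Set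
  Q ⊑ V = ∃ λ S → Q ++ S ↭ V

  open CommutativeMonoidSolver (++-commutativeMonoid {A = A}) using (solve; _⊜_; _⊕_)

  ⊑-refl : ∀ {V} → V ⊑ V
  ⊑-refl {V} = [] , ++-identityʳ V

  ⊑-trans : ∀ {Q W V} → Q ⊑ W → W ⊑ V → Q ⊑ V
  ⊑-trans {Q} (S , p) (S′ , q) =
    S ++ S′ , ↭-trans (↭-sym (++-assoc Q S S′)) (↭-trans (++⁺ʳ S′ p) q)

  rest-⊑ : ∀ {Q S V} → Q ++ S ↭ V → S ⊑ V
  rest-⊑ {Q} {S} p = Q , ↭-trans (++-comm S Q) p

  ⊑-length : ∀ {Q V} → Q ⊑ V → length Q ≤ length V
  ⊑-length {Q} (S , p) = ≤-trans (m≤m+n _ _) (≤-reflexive (trans (sym (length-++ Q)) (↭-length p)))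

  take-⊑ : ∀ {m} V → m ≤ length V → ∃ λ S → S ⊑ V × length S ≡ m
  take-⊑ {m} V m≤ = take m V , (drop m V , ↭-reflexive (take++drop≡id m V)) ,
    trans (length-take m V) (m≤n⇒m⊓n≡m m≤)

  All-⊑ : ∀ {P : A → Set} {Q V} → Q ⊑ V → All P V → All P Q
  All-⊑ {Q = Q} (_ , p) = All.++⁻ˡ Q ∘ All-resp-↭ (↭-sym p)

  -- Surgery on a path needs the position of an entry, that is, what precedes and what follows it.
  All-splits : ∀ {P : A → Set} S → (∀ S₁ s S₂ → S ≡ S₁ ++ s ∷ S₂ → P s) → All P S
  All-splits []      f = []
  All-splits (x ∷ S) f = f [] x S refl ∷ All-splits S (λ S₁ s S₂ → f (x ∷ S₁) s S₂ ∘ cong (x ∷_))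

  removeAt-↭ : ∀ (V : List A) i → lookup V i ∷ removeAt V i ↭ V
  removeAt-↭ (x ∷ V) zero    = ↭-refl
  removeAt-↭ (x ∷ V) (suc i) = ↭-trans (↭-swap _ x ↭-refl) (↭-prep x (removeAt-↭ V i))

  ∷-↭⇒lookup : ∀ {y : A} {L V} → y ∷ L ↭ V → ∃ λ i → y ≡ lookup V i × L ↭ removeAt V i
  ∷-↭⇒lookup {y} {L} {V} p = i , y≡ ,
    drop-∷ (↭-trans p (↭-trans (↭-sym (removeAt-↭ V i)) (↭-reflexive (cong (_∷ removeAt V i) (sym y≡)))))
    where
    y∈V = ∈-resp-↭ p (here refl)
    i   = index y∈V
    y≡  = lookup-index y∈V

  two-lookups-↭ : ∀ (T : List A) {i j} → i ≢ j → ∃ λ S → lookup T i ∷ lookup T j ∷ S ↭ T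
  two-lookups-↭ (x ∷ T) {zero}  {zero}  i≢j = contradiction refl i≢j
  two-lookups-↭ (x ∷ T) {zero}  {suc j} i≢j = removeAt T j , ↭-prep x (removeAt-↭ T j)
  two-lookups-↭ (x ∷ T) {suc i} {zero}  i≢j = removeAt T i , ↭-trans (↭-swap _ x ↭-refl) (↭-prep x (removeAt-↭ T i))
  two-lookups-↭ (x ∷ T) {suc i} {suc j} i≢j with two-lookups-↭ T (i≢j ∘ cong suc)
  ... | S , p = x ∷ S , ↭-trans (shift x (_ ∷ _ ∷ []) S) (↭-prep x p)

  -- A linked list is a path once its entries are known to be distinct, which ⊑ guarantees for a
  -- duplicate-free V.
  module Paths (R : A → A → Set) (R? : Decidable R) (R-sym : Symmetric R) where

    PathsBounded : ℕ → List A → Set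
    PathsBounded l V = ∀ {Q} → Linked R Q → Q ⊑ V → length Q ≤ l

    PathsBounded-⊑ : ∀ {l W V} → W ⊑ V → PathsBounded l V → PathsBounded l W
    PathsBounded-⊑ W⊑V bound linked Q⊑W = bound linked (⊑-trans Q⊑W W⊑V)

    -- Cutting, gluing and reversing paths.

    linked-++⁻ʳ : ∀ xs {ys} → Linked R (xs ++ ys) → Linked R ys
    linked-++⁻ʳ []           l       = l
    linked-++⁻ʳ (x ∷ [])     [-]     = []
    linked-++⁻ʳ (x ∷ [])     (_ ∷ l) = l
    linked-++⁻ʳ (x ∷ y ∷ xs) (_ ∷ l) = linked-++⁻ʳ (y ∷ xs) l

    linked-++⁻ˡ : ∀ xs {ys} → Linked R (xs ++ ys) → Linked R xs
    linked-++⁻ˡ []           l       = []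
    linked-++⁻ˡ (x ∷ [])     l       = [-]
    linked-++⁻ˡ (x ∷ y ∷ xs) (r ∷ l) = r ∷ linked-++⁻ˡ (y ∷ xs) l

    linked-glue : ∀ xs {u ys} → Linked R (xs ++ [ u ]) → Linked R (u ∷ ys) → Linked R (xs ++ u ∷ ys)
    linked-glue []           _       l = l
    linked-glue (x ∷ [])     (r ∷ _) l = r ∷ l
    linked-glue (x ∷ y ∷ xs) (r ∷ k) l = r ∷ linked-glue (y ∷ xs) k l

    linked-ʳ++ : ∀ {x ys} xs → Linked R (x ∷ xs) → Linked R (x ∷ ys) → Linked R (xs ʳ++ x ∷ ys)
    linked-ʳ++ []       _       l = l
    linked-ʳ++ (y ∷ xs) (r ∷ k) l = linked-ʳ++ xs k (R-sym r ∷ l)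

    linked-reverse : ∀ {xs} → Linked R xs → Linked R (reverse xs)
    linked-reverse []                  = []
    linked-reverse [-]                 = [-]
    linked-reverse {x ∷ y ∷ xs} (r ∷ l) = linked-ʳ++ (y ∷ xs) (r ∷ l) [-]

    -- Existence of a longest path by exhaustive search.

    continuesFrom? : ∀ s x V → Dec (∃ λ Q → length Q ≡ s × Linked R (x ∷ Q) × Q ⊑ V)
    continuesFrom? zero    x V = yes ([] , refl , [-] , V , ↭-refl)
    continuesFrom? (suc s) x V = map′ to from (any? step?)
      where
      Step : Fin (length V) → Set
      Step i = R x (lookup V i) ×
        ∃ λ Q → length Q ≡ s × Linked R (lookup V i ∷ Q) × Q ⊑ removeAt V i
      step? : ∀ i → Dec (Step i)
      step? i with R? x (lookup V i) | continuesFrom? s (lookup V i) (removeAt V i)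
      ... | yes r | yes c = yes (r , c)
      ... | no ¬r | _     = no (¬r ∘ proj₁)
      ... | _     | no ¬c = no (¬c ∘ proj₂)
      to : ∃ Step → _
      to (i , r , Q , len , l , S , p) =
        lookup V i ∷ Q , cong suc len , r ∷ l , S , ↭-trans (↭-prep _ p) (removeAt-↭ V i)
      from : _ → ∃ Step
      from (y ∷ Q , len , r ∷ l , S , p) with ∷-↭⇒lookup p
      ... | i , refl , q = i , r , Q , suc-injective len , l , S , q

    pathOfLength? : ∀ s V → Dec (∃ λ Q → length Q ≡ s × Linked R Q × Q ⊑ V)
    pathOfLength? zero    V = yes ([] , refl , [] , V , ↭-refl)
    pathOfLength? (suc s) V = map′ to from (any? (λ i → continuesFrom? s (lookup V i) (removeAt V i)))
      where
      to : _ → _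
      to (i , Q , len , l , S , p) =
        lookup V i ∷ Q , cong suc len , l , S , ↭-trans (↭-prep _ p) (removeAt-↭ V i)
      from : _ → _
      from (y ∷ Q , len , l , S , p) with ∷-↭⇒lookup p
      ... | i , refl , q = i , Q , suc-injective len , l , S , q

    LongestPath : List A → Set
    LongestPath V = ∃ λ Q → Linked R Q × Q ⊑ V × PathsBounded (length Q) V

    longestPath : ∀ V → LongestPath V
    longestPath V = search (length V) (λ _ → ⊑-length)
      where
      search : ∀ s → PathsBounded s V → LongestPath V
      search zero    bound = [] , [] , (V , ↭-refl) , bound
      search (suc s) bound with pathOfLength? (suc s) V
      ... | yes (Q , len , l , Q⊑V) = Q , l , Q⊑V , subst (λ n → PathsBounded n V) (sym len) bound
      ... | no none = search s λ {Q} l Q⊑V →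
        ≤-pred (≤∧≢⇒< (bound l Q⊑V) (λ len → none (Q , len , l , Q⊑V)))

    -- Depth-first search.

    Blue : List A → List A → Set
    Blue U T = All (λ u → All (λ t → ¬ R u t) T) U

    Blue-⊑ʳ : ∀ {U T T′} → T′ ⊑ T → Blue U T → Blue U T′
    Blue-⊑ʳ T′⊑T = All.map (All-⊑ T′⊑T)

    redNeighbour? : ∀ T x → (∃ λ i → R x (lookup T i)) ⊎ All (λ t → ¬ R x t) T
    redNeighbour? T x with any? (λ i → R? x (lookup T i))
    ... | yes found = inj₁ found
    ... | no none   = inj₂ (All-splits T (λ T₁ t T₂ eq r → none (at T₁ eq r)))
      where
      at : ∀ T₁ {t T₂ T} → T ≡ T₁ ++ t ∷ T₂ → R x t → ∃ λ i → R x (lookup T i)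
      at []       refl r = zero , r
      at (_ ∷ T₁) refl r = let i , r′ = at T₁ refl r in suc i , r′

    -- Depth-first search: Q is the stack, U the finished and T the undiscovered vertices.
    dfs : ∀ m V → m ≤ length V →
          ∃ λ U → ∃₂ λ Q T → length U ≡ m × Linked R Q × Blue U T × U ++ Q ++ T ↭ V
    dfs m V m≤V = go (length V) [] refl [] [] ↭-refl z≤n
      where
      -- The recursion is lexicographic: t drops when a vertex is pushed, and Q shrinks when one is
      -- finished. A vertex enters U only when it has no red neighbour in T, and T never grows, so
      -- `Blue U T` persists.
      go : ∀ t Q {U T} → length T ≡ t → Linked R Q → Blue U T → U ++ Q ++ T ↭ V → length U ≤ m →
           ∃ λ U → ∃₂ λ Q T → length U ≡ m × Linked R Q × Blue U T × U ++ Q ++ T ↭ V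
      go t Q {U} {T} len l b p U≤m with length U ≟ m
      ... | yes done = U , Q , T , done , l , b , p
      -- With the stack and T both empty, U exhausts V and so has at least m vertices.
      go t [] {U} {[]} len l b p U≤m | no U≢m =
        contradiction (≤-antisym U≤m (≤-trans m≤V (≤-reflexive (trans (↭-length (↭-sym p))
          (trans (length-++ U) (+-identityʳ _)))))) U≢m
      go (suc t) [] {U} {x ∷ T} len l b p U≤m | no U≢m =
        go t [ x ] (suc-injective len) [-] (All.map All.tail b) p U≤m
      go t (q ∷ Q) {U} {T} len l b p U≤m | no U≢m with redNeighbour? T q
      go zero (q ∷ Q) {U} {[]} len l b p U≤m | no U≢m | inj₁ (() , _)
      go (suc t) (q ∷ Q) {U} {T@(_ ∷ _)} len l b p U≤m | no U≢m | inj₁ (i , r) =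
        go t (lookup T i ∷ q ∷ Q) (suc-injective (trans (↭-length (removeAt-↭ T i)) len)) (R-sym r ∷ l)
          (All.map (All.tail ∘ All-resp-↭ (↭-sym (removeAt-↭ T i))) b)
          (↭-trans (++⁺ˡ U (↭-trans (↭-sym (shift (lookup T i) (q ∷ Q) (removeAt T i)))
            (++⁺ˡ (q ∷ Q) (removeAt-↭ T i)))) p)
          U≤m
      go t (q ∷ Q) {U} {T} len l b p U≤m | no U≢m | inj₂ q-blue =
        go t Q {q ∷ U} len (linked-++⁻ʳ [ q ] l) (q-blue ∷ b)
          (↭-trans (↭-sym (shift q U (Q ++ T))) p) (≤∧≢⇒< U≤m U≢m)

    -- Blue complete multipartite graphs from depth-first search.

    data BlueMultipartite : List ℕ → List A → Set where
      []   : BlueMultipartite [] []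
      part : ∀ {m ms S T} → length S ≡ m → Blue S T → BlueMultipartite ms T →
             BlueMultipartite (m ∷ ms) (S ++ T)

    BlueMultipartite-length : ∀ {ms T} → BlueMultipartite ms T → length T ≡ sum ms
    BlueMultipartite-length []              = refl
    BlueMultipartite-length (part {S = S} len _ K) =
      trans (length-++ S) (cong₂ _+_ len (BlueMultipartite-length K))

    HasBlueK : List ℕ → List A → Set
    HasBlueK ms V = ∃ λ T → BlueMultipartite ms T × T ⊑ V

    -- A search stopped at m finished vertices loses only its stack, a path of at most l vertices.
    -- The undiscovered vertices are joined to the finished ones in blue and contain the remaining
    -- parts by induction.
    dfs-HasBlueK : ∀ {l} m ms V → PathsBounded l V →
                   length ms * l + (m + sum ms) ≤ length V → HasBlueK (m ∷ ms) V
    dfs-HasBlueK m [] V bound big with take-⊑ V (≤-trans (m≤m+n m 0) big)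
    ... | S , (S′ , p) , len = S ++ [] , part len (All.universal (λ _ → []) S) [] ,
      S′ , ↭-trans (++⁺ʳ S′ (++-identityʳ S)) p
    dfs-HasBlueK {l} m (m′ ∷ ms) V bound big
      with dfs m V (≤-trans (≤-trans (m≤m+n m _) (m≤n+m _ (suc (length ms) * l))) big)
    ... | U , Q , T , len , linked , blue , p
      with dfs-HasBlueK m′ ms T (PathsBounded-⊑ T⊑V bound) T-big
      where
      T⊑V : T ⊑ V
      T⊑V = U ++ Q , ↭-trans (solve 3 (λ a b c → c ⊕ (a ⊕ b) ⊜ a ⊕ (b ⊕ c)) ↭-refl U Q T) p
      Q≤l : length Q ≤ l
      Q≤l = bound linked (U ++ T ,
        ↭-trans (solve 3 (λ a b c → b ⊕ (a ⊕ c) ⊜ a ⊕ (b ⊕ c)) ↭-refl U Q T) p)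
      |V| : length V ≡ m + (length Q + length T)
      |V| = trans (sym (↭-length p)) (trans (length-++ U) (cong₂ _+_ len (length-++ Q)))
      T-big : length ms * l + (m′ + sum ms) ≤ length T
      T-big = by-slack 0 (+-mono-≤ (subst (_ ≤_) |V| big) Q≤l)
        (eq (length ms * l) m′ (sum ms) m (length Q) (length T) l)
        where
        eq : ∀ a b c m q t l → (a + (b + c)) + ((m + (q + t)) + l) + 0 ≡ t + ((l + a) + (m + (b + c)) + q)
        eq = solve-∀
    ... | T′ , K , T′⊑T = U ++ T′ , part len (Blue-⊑ʳ T′⊑T blue) K ,
      (let S , q = T′⊑T in Q ++ S , ↭-trans
        (solve 4 (λ a b c d → (a ⊕ b) ⊕ (c ⊕ d) ⊜ a ⊕ (c ⊕ (b ⊕ d))) ↭-refl U T′ Q S)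
        (↭-trans (++⁺ˡ U (++⁺ˡ Q q)) p))

    -- Paths attached to a longest path, and parts cut from successive longest paths.

    StartsPath : ℕ → List A → A → Set
    StartsPath z V t = ∃ λ Q → Linked R (t ∷ Q) × t ∷ Q ⊑ V × z ≤ length (t ∷ Q)

    -- The path from t, run backwards, continues from s to the end of the longest path.
    path-attached-early : ∀ {V R′ z t} Q₁ {s Q₂} → Linked R (Q₁ ++ s ∷ Q₂) → (Q₁ ++ s ∷ Q₂) ++ R′ ↭ V →
      PathsBounded (length (Q₁ ++ s ∷ Q₂)) V → StartsPath z R′ t → R s t → z ≤ length Q₁
    path-attached-early {V} {R′} {z} {t} Q₁ {s} {Q₂} linked p bound (P , P-linked , (S , q) , z≤) r =
      by-slack 0 (+-mono-≤ z≤ longer) (trans (cong (λ a → z + (length (t ∷ P) + a) + 0)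
          (length-++ Q₁))
        (trans (eq z (length (t ∷ P)) (length Q₁) (suc (length Q₂)))
          (cong (λ a → length Q₁ + (z + a)) (sym (length-ʳ++ (t ∷ P))))))
      where
      longer = bound {(t ∷ P) ʳ++ s ∷ Q₂}
        (linked-ʳ++ P P-linked (R-sym r ∷ linked-++⁻ʳ Q₁ linked))
        (Q₁ ++ S , ↭-trans (++⁺ʳ (Q₁ ++ S) (↭-sym (++↭ʳ++ (t ∷ P) (s ∷ Q₂))))
          (↭-trans (solve 4 (λ a b c d → (a ⊕ b) ⊕ (c ⊕ d) ⊜ (c ⊕ b) ⊕ (a ⊕ d)) ↭-refl (t ∷ P) (s ∷ Q₂) Q₁ S)
            (↭-trans (++⁺ˡ (Q₁ ++ s ∷ Q₂) q) p)))
      eq : ∀ z p a b → z + (p + (a + b)) + 0 ≡ a + (z + (p + b))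
      eq = solve-∀

    -- By `path-attached-early`, a red edge from s to a vertex of T needs at least z vertices before
    -- s, but fewer than `length S` ≤ z precede a vertex of S.
    prefix-blue : ∀ {V R′ z T} S {Q} → Linked R (S ++ Q) → (S ++ Q) ++ R′ ↭ V →
      PathsBounded (length (S ++ Q)) V → length S ≤ z → All (StartsPath z R′) T → Blue S T
    prefix-blue {V} {R′} {z} S {Q} linked p bound S≤z starts = All-splits S λ S₁ s S₂ eq →
      All.map (λ start r → <⇒≱ (short S₁ s S₂ eq) (≤-trans S≤z (early S₁ s S₂ eq start r))) starts
      where
      short : ∀ S₁ s S₂ → S ≡ S₁ ++ s ∷ S₂ → length S₁ < length S
      short S₁ s S₂ refl = subst (length S₁ <_) (sym (length-++ S₁)) (m<m+n (length S₁) (s≤s z≤n))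
      early : ∀ S₁ s S₂ → S ≡ S₁ ++ s ∷ S₂ → ∀ {t} → StartsPath z R′ t → R s t → z ≤ length S₁
      early S₁ s S₂ refl start r = path-attached-early S₁ (subst (Linked R) assoc linked)
        (subst (λ P → P ++ R′ ↭ V) assoc p) (subst (λ P → PathsBounded (length P) V) assoc bound)
        start r
        where
        assoc = List.++-assoc S₁ (s ∷ S₂) Q

    -- Each path used has at least h + 1 vertices and its part lies among the first `sum ms` of
    -- them, so at least h + 1 - `sum ms` vertices follow from there on. Quantifying over z avoids
    -- truncated subtraction.
    BlueKOfStarts : List ℕ → ℕ → List A → Set
    BlueKOfStarts ms h V = ∃ λ T → BlueMultipartite ms T × T ⊑ V ×
      (∀ z → z + sum ms ≤ suc h → All (StartsPath z V) T)

    -- The inequality says that at most `length ms` - 1 paths, each of at most l vertices, were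
    -- removed from V to reach W.
    SmallRemainder : List ℕ → ℕ → ℕ → List A → Set
    SmallRemainder ms l h V = ∃ λ W → W ⊑ V × PathsBounded h W ×
      length V + l ≤ length W + length ms * l

    -- Each part is an initial segment of a longest path in what the previous paths leave over.
    initialSegments : ∀ {l h} ms V → sum ms ≤ h → PathsBounded l V →
                      BlueKOfStarts ms h V ⊎ SmallRemainder ms l h V
    initialSegments [] V _ _ = inj₁ ([] , [] , (V , ↭-refl) , λ _ _ → [])
    initialSegments {l} {h} (m ∷ ms) V sum≤h bound with longestPath V
    ... | Q , linked , (V′ , p) , longest with length Q ≤? h
    ...   | yes Q≤h = inj₂ (V , ⊑-refl , (λ k k⊑V → ≤-trans (longest k k⊑V) Q≤h) ,
              +-monoʳ-≤ (length V) (m≤m+n l (length ms * l)))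
    ...   | no Q≰h
      with initialSegments ms V′ (≤-trans (m≤n+m (sum ms) m) sum≤h) (PathsBounded-⊑ (rest-⊑ p) bound)
    ... | inj₂ (W , W⊑V′ , W-bound , big) = inj₂ (W , ⊑-trans W⊑V′ (rest-⊑ p) , W-bound ,
          by-slack 0 (+-mono-≤ big (bound linked (V′ , p)))
            (trans (cong (λ v → v + l + _ + 0) |V|) (eq (length Q) (length V′) l (length W) (length ms * l))))
      where
      |V| : length V ≡ length Q + length V′
      |V| = trans (sym (↭-length p)) (length-++ Q)
      eq : ∀ q v l w a → q + v + l + (w + a + l) + 0 ≡ w + (l + a) + (v + l + q)
      eq = solve-∀
    ... | inj₁ (T , K , (V″ , q) , starts) =
      inj₁ (S ++ T , part |S| S-T K , (Q″ ++ V″ , S++T⊑V) , λ z z≤ → All.++⁺ (S-starts z z≤)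
        (All.map (λ (P , k , P⊑V′ , z≤P) → P , k , ⊑-trans P⊑V′ (rest-⊑ p) , z≤P)
          (starts z (≤-trans (+-monoʳ-≤ z (m≤n+m (sum ms) m)) z≤))))
      where
      S  = take m Q
      Q″ = drop m Q
      Q≡ : S ++ Q″ ≡ Q
      Q≡ = take++drop≡id m Q
      m≤h : m ≤ h
      m≤h = ≤-trans (m≤m+n m (sum ms)) sum≤h
      |S| : length S ≡ m
      |S| = trans (length-take m Q) (m≤n⇒m⊓n≡m (≤-trans m≤h (<⇒≤ (≰⇒> Q≰h))))
      S++T⊑V : (S ++ T) ++ (Q″ ++ V″) ↭ V
      S++T⊑V = ↭-trans (solve 4 (λ a b c d → (a ⊕ b) ⊕ (c ⊕ d) ⊜ (a ⊕ c) ⊕ (b ⊕ d)) ↭-refl S T Q″ V″)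
        (↭-trans (++⁺ (↭-reflexive Q≡) q) p)
      Q-split : ∀ S₁ s S₂ → S ≡ S₁ ++ s ∷ S₂ → Q ≡ S₁ ++ s ∷ (S₂ ++ Q″)
      Q-split S₁ s S₂ eq = trans (sym Q≡) (trans (cong (_++ Q″) eq) (List.++-assoc S₁ (s ∷ S₂) Q″))
      S₁-short : ∀ S₁ s S₂ → S ≡ S₁ ++ s ∷ S₂ → suc (length S₁) ≤ m
      S₁-short S₁ s S₂ eq = ≤-trans (m≤m+n (suc (length S₁)) (length S₂)) (≤-reflexive (sym
        (trans (sym |S|) (trans (cong length eq) (trans (length-++ S₁) (+-suc (length S₁) (length S₂)))))))
      -- Vertices of T start paths of more than m vertices off Q, while fewer than m vertices of Q
      -- precede any vertex of S.
      S-T : Blue S T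
      S-T = prefix-blue S (subst (Linked R) (sym Q≡) linked) (↭-trans (++⁺ʳ V′ (↭-reflexive Q≡)) p)
        (subst (λ Q → PathsBounded (length Q) V) (sym Q≡) longest) (≤-trans (≤-reflexive |S|) (n≤1+n m))
        (starts (suc m) (s≤s sum≤h))
      S-starts : ∀ z → z + (m + sum ms) ≤ suc h → All (StartsPath z V) S
      S-starts z z≤ = All-splits S λ S₁ s S₂ eq →
        S₂ ++ Q″ ,
        linked-++⁻ʳ S₁ (subst (Linked R) (Q-split S₁ s S₂ eq) linked) ,
        (S₁ ++ V′ , ↭-trans
          (solve 3 (λ a b c → b ⊕ (a ⊕ c) ⊜ (a ⊕ b) ⊕ c) ↭-refl S₁ (s ∷ S₂ ++ Q″) V′)
          (subst (λ Q → Q ++ V′ ↭ V) (Q-split S₁ s S₂ eq) p)) ,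
        by-slack (suc (sum ms)) (+-mono-≤ (+-mono-≤ z≤ (S₁-short S₁ s S₂ eq))
            (subst (h <_) (trans (cong length (Q-split S₁ s S₂ eq)) (length-++ S₁)) (≰⇒> Q≰h)))
          (ar z h m (length S₁) (length (S₂ ++ Q″)) (sum ms))
        where
        ar : ∀ z h m a b s → z + (suc h + m + (a + suc b)) + suc s ≡ suc b + (z + (m + s) + suc a + suc h)
        ar = solve-∀

    -- Detours off a longest path, and the count of its vertices joined to T in blue.

    data Transition (t t′ : A) : List A → Set where
      here  : ∀ {x y S} → R x t → R y t′ → Transition t t′ (x ∷ y ∷ S)
      there : ∀ {x S} → Transition t t′ S → Transition t t′ (x ∷ S)

    transition-split : ∀ {t t′ S} → Transition t t′ S →
      ∃₂ λ C u → ∃₂ λ v B → S ≡ C ++ u ∷ v ∷ B × R u t × R v t′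
    transition-split (here r r′) = [] , _ , _ , _ , refl , r , r′
    transition-split {S = x ∷ _} (there o) with transition-split o
    ... | C , u , v , B , refl , r , r′ = x ∷ C , u , v , B , refl , r , r′

    -- Inserting t between x and y would lengthen the path.
    no-detour : ∀ {V t S} A₁ {x y B} → Linked R (A₁ ++ x ∷ y ∷ B) → R x t → R y t →
      (A₁ ++ x ∷ y ∷ B) ++ t ∷ S ↭ V → ¬ PathsBounded (length (A₁ ++ x ∷ y ∷ B)) V
    no-detour {V} {t} {S} A₁ {x} {y} {B} linked rx ry p bound =
      1+n≰n (≤-trans (≤-reflexive (↭-length (↭-sym inserted)))
        (bound (linked-glue A₁ (linked-++⁻ˡ (A₁ ++ [ x ]) (subst (Linked R) (sym assoc) linked))
            (rx ∷ R-sym ry ∷ linked-++⁻ʳ (A₁ ++ [ x ]) (subst (Linked R) (sym assoc) linked)))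
          (S , ↭-trans (++⁺ʳ S inserted) (↭-trans (↭-sym (shift t (A₁ ++ x ∷ y ∷ B) S)) p))))
      where
      assoc = List.++-assoc A₁ [ x ] (y ∷ B)
      inserted : A₁ ++ x ∷ t ∷ y ∷ B ↭ t ∷ A₁ ++ x ∷ y ∷ B
      inserted = solve 4 (λ a b c d → a ⊕ (b ⊕ (c ⊕ d)) ⊜ c ⊕ (a ⊕ (b ⊕ d))) ↭-refl A₁ [ x ] [ t ] (y ∷ B)

    -- The segment D from y to u is traversed backwards between t and t′.
    no-double-detour : ∀ {V t t′ S} A₁ {x y D v B} C {u} → y ∷ D ≡ C ++ [ u ] →
      Linked R (A₁ ++ x ∷ (y ∷ D) ++ v ∷ B) → R x t → R y t′ → R u t → R v t′ →
      (A₁ ++ x ∷ (y ∷ D) ++ v ∷ B) ++ t ∷ t′ ∷ S ↭ V →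
      ¬ PathsBounded (length (A₁ ++ x ∷ (y ∷ D) ++ v ∷ B)) V
    no-double-detour {V} {t} {t′} {S} A₁ {x} {y} {D} {v} {B} C {u} eq linked xt yt′ ut vt′ p bound =
      1+n≰n (≤-trans (n≤1+n _) (≤-trans (≤-reflexive (↭-length (↭-sym inserted)))
        (bound (linked-glue A₁ (linked-++⁻ˡ (A₁ ++ [ x ]) (subst (Linked R) (sym assoc) linked))
            (subst (λ L → Linked R (x ∷ t ∷ L)) (sym reversed) (xt ∷ R-sym ut ∷
              subst (Linked R) reversed (linked-ʳ++ D (linked-++⁻ˡ (y ∷ D) rear)
                (yt′ ∷ R-sym vt′ ∷ linked-++⁻ʳ (y ∷ D) rear)))))
          (S , ↭-trans (++⁺ʳ S inserted) (↭-trans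
            (solve 4 (λ a b c d → (a ⊕ (b ⊕ c)) ⊕ d ⊜ c ⊕ (a ⊕ (b ⊕ d))) ↭-refl [ t ] [ t′ ] P S) p)))))
      where
      P = A₁ ++ x ∷ (y ∷ D) ++ v ∷ B
      assoc = List.++-assoc A₁ [ x ] ((y ∷ D) ++ v ∷ B)
      rear = linked-++⁻ʳ (A₁ ++ [ x ]) (subst (Linked R) (sym assoc) linked)
      reversed : (y ∷ D) ʳ++ t′ ∷ v ∷ B ≡ u ∷ (C ʳ++ t′ ∷ v ∷ B)
      reversed = trans (cong (_ʳ++ t′ ∷ v ∷ B) eq) (List.++-ʳ++ C)
      inserted : A₁ ++ x ∷ t ∷ ((y ∷ D) ʳ++ t′ ∷ v ∷ B) ↭ t ∷ t′ ∷ P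
      inserted = ↭-trans (++⁺ˡ A₁ (++⁺ˡ (x ∷ t ∷ []) (↭-sym (++↭ʳ++ (y ∷ D) (t′ ∷ v ∷ B)))))
        (solve 6 (λ a b c d e f → a ⊕ (b ⊕ (c ⊕ (d ⊕ (e ⊕ f)))) ⊜ c ⊕ (e ⊕ (a ⊕ (b ⊕ (d ⊕ f))))) ↭-refl
          A₁ [ x ] [ t ] (y ∷ D) [ t′ ] (v ∷ B))

    -- A second occurrence of (t, t′), at u and v, allows the double detour. It may overlap the
    -- first one: in the case u = y the reversed segment is y alone.
    transition-unique : ∀ {V t t′ S} A₁ {x y B Post} → Linked R (A₁ ++ x ∷ y ∷ B ++ Post) →
      R x t → R y t′ → Transition t t′ (y ∷ B) → (A₁ ++ x ∷ y ∷ B ++ Post) ++ t ∷ t′ ∷ S ↭ V →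
      ¬ PathsBounded (length (A₁ ++ x ∷ y ∷ B ++ Post)) V
    transition-unique {V} {t} {t′} {S} A₁ {x} {y} {_} {Post} linked xt yt′ o p bound with transition-split o
    ... | [] , u , v , B , refl , ut , vt′ =
      no-double-detour A₁ [] refl linked xt yt′ ut vt′ p bound
    ... | _ ∷ C , u , v , B , refl , ut , vt′ =
      no-double-detour A₁ (y ∷ C) refl (subst (Linked R) assoc linked) xt yt′ ut vt′
        (subst (λ P → P ++ t ∷ t′ ∷ S ↭ V) assoc p) (subst (λ P → PathsBounded (length P) V) assoc bound)
      where
      assoc : A₁ ++ x ∷ y ∷ (C ++ u ∷ v ∷ B) ++ Post ≡ A₁ ++ x ∷ (y ∷ C ++ [ u ]) ++ v ∷ (B ++ Post)
      assoc = cong (λ L → A₁ ++ x ∷ y ∷ L)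
        (trans (List.++-assoc C (u ∷ v ∷ B) Post) (sym (List.++-assoc C [ u ] (v ∷ B ++ Post))))

    -- `pairs` holds positions in T rather than vertices, ready for `off-diagonal-≤`. The excess e
    -- is 1 when S begins with a vertex that has a red neighbour in T, and 0 otherwise.
    record Balance (T S : List A) (e : ℕ) : Set where
      field
        {blues reds} : List A
        partition    : blues ++ reds ↭ S
        nonadjacent  : Blue blues T
        pairs        : List (Fin (length T) × Fin (length T))
        transitions  : All (λ (i , j) → i ≢ j × Transition (lookup T i) (lookup T j) S) pairs
        unique       : Unique pairs
        balanced     : length reds ≤ length blues + length pairs + e

    -- Every vertex with a red neighbour in T is followed by a vertex without one or starts a transition;
    -- the excess 1 pays for the last vertex of S.
    module _ {V T Rest P : List A} (linked : Linked R P) (p : P ++ T ++ Rest ↭ V)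
             (bound : PathsBounded (length P) V) (Post : List A) where

      StartsRed : List A → Set
      StartsRed S = ∃₂ λ x S′ → S ≡ x ∷ S′ × (∃ λ i → R x (lookup T i)) × Balance T S 1

      balance : ∀ A₁ S → P ≡ A₁ ++ S ++ Post → Balance T S 0 ⊎ StartsRed S
      balance A₁ [] eq = inj₁ record
        { partition = ↭-refl ; nonadjacent = [] ; pairs = [] ; transitions = [] ; unique = [] ; balanced = z≤n }
      balance A₁ (x ∷ S) eq
        with redNeighbour? T x | balance (A₁ ++ [ x ]) S (trans eq (sym (List.++-assoc A₁ [ x ] (S ++ Post))))
      ... | inj₂ x-blue | rec = inj₁ (add-blue rec)
        where
        -- The vertex x counts among the blues and so absorbs the excess of a red run following it.
        add : ∀ {e} → e ≤ 1 → Balance T S e → Balance T (x ∷ S) 0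
        add {e} e≤1 b = record
          { partition = ↭-prep x partition ; nonadjacent = x-blue ∷ nonadjacent ; pairs = pairs
          ; transitions = All.map (λ (i≢j , o) → i≢j , there o) transitions ; unique = unique
          ; balanced = by-slack 0 (+-mono-≤ balanced e≤1)
              (eq′ (length reds) (length blues) (length pairs) e) }
          where
          open Balance b
          eq′ : ∀ r b p e → r + (b + p + e + 1) + 0 ≡ suc b + p + 0 + (r + e)
          eq′ = solve-∀
        add-blue : Balance T S 0 ⊎ StartsRed S → Balance T (x ∷ S) 0
        add-blue (inj₁ b)                   = add z≤n b
        add-blue (inj₂ (_ , _ , _ , _ , b)) = add ≤-refl b
      ... | inj₁ x-red | inj₁ b = inj₂ (x , S , refl , x-red , record
          { partition = ↭-trans (shift x blues reds) (↭-prep x partition) ; nonadjacent = nonadjacent ; pairs = pairs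
          ; transitions = All.map (λ (i≢j , o) → i≢j , there o) transitions ; unique = unique
          ; balanced = ≤-trans (s≤s balanced) (≤-reflexive (eq′ (length blues) (length pairs))) })
        where
        open Balance b
        eq′ : ∀ b p → suc (b + p + 0) ≡ b + p + 1
        eq′ = solve-∀
      -- Two consecutive vertices with red neighbours: the new pair (i, j) pays for x, and the
      -- excess stays with the end of the run.
      ... | inj₁ x-red@(i , r) | inj₂ (y , S′ , refl , (j , r′) , b) = inj₂ (x , S , refl , x-red , record
          { partition = ↭-trans (shift x blues reds) (↭-prep x partition) ; nonadjacent = nonadjacent ; pairs = (i , j) ∷ pairs
          ; transitions = (i≢j , here r r′) ∷ All.map (λ (i≢j , o) → i≢j , there o) transitions
          ; unique = All.map (λ { (_ , o) refl → no-repeat o }) transitions ∷ unique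
          ; balanced = ≤-trans (s≤s balanced) (≤-reflexive (eq′ (length blues) (length pairs))) })
        where
        open Balance b
        eq′ : ∀ b p → suc (b + p + 1) ≡ b + suc p + 1
        eq′ = solve-∀
        linked′ = subst (Linked R) eq linked
        p′      = subst (λ P → P ++ T ++ Rest ↭ V) eq p
        bound′  = subst (λ P → PathsBounded (length P) V) eq bound
        i≢j : i ≢ j
        i≢j refl = no-detour A₁ linked′ r r′
          (↭-trans (++⁺ˡ (A₁ ++ x ∷ y ∷ S′ ++ Post) (++⁺ʳ Rest (removeAt-↭ T i))) p′) bound′
        no-repeat : ¬ Transition (lookup T i) (lookup T j) (y ∷ S′)
        no-repeat o = transition-unique A₁ linked′ r r′ o
          (↭-trans (++⁺ˡ (A₁ ++ x ∷ y ∷ S′ ++ Post) (++⁺ʳ Rest (proj₂ (two-lookups-↭ T i≢j)))) p′) bound′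

    -- All 2 z end vertices are kept. In `Mid` the discarded vertices outnumber the kept ones by at
    -- most the number of ordered pairs of distinct positions in T, plus 1.
    blueOnPath : ∀ {V T Rest} z Pre Mid Post → Linked R (Pre ++ Mid ++ Post) →
      (Pre ++ Mid ++ Post) ++ T ++ Rest ↭ V → PathsBounded (length (Pre ++ Mid ++ Post)) V →
      length Pre ≡ z → length Post ≡ z → Blue Pre T → Blue Post T →
      ∃ λ W → W ⊑ Pre ++ Mid ++ Post × Blue W T ×
        length (Pre ++ Mid ++ Post) + 2 * z ≤ 2 * length W + length T * pred (length T) + 1
    blueOnPath {T = T} z Pre Mid Post linked p bound |Pre| |Post| Pre-blue Post-blue =
      Pre ++ blues ++ Post ,
      (reds , ↭-trans (solve 4 (λ a b c d → (a ⊕ (b ⊕ c)) ⊕ d ⊜ a ⊕ ((b ⊕ d) ⊕ c)) ↭-refl Pre blues Post reds)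
        (++⁺ˡ Pre (++⁺ʳ Post partition))) ,
      All.++⁺ Pre-blue (All.++⁺ nonadjacent Post-blue) ,
      subst₂ (λ l w → l + 2 * z ≤ 2 * w + D + 1) (sym |P|) (sym |W|)
        (by-slack 0 (+-mono-≤ balanced (off-diagonal-≤ pairs unique (All.map proj₁ transitions)))
          (eq z (length blues) (length reds) (length pairs) D))
      where
      D = length T * pred (length T)
      excess : Balance T Mid 0 ⊎ StartsRed linked p bound Post Mid → Balance T Mid 1
      excess (inj₁ b) = record { Balance b ; balanced = ≤-trans (Balance.balanced b) (+-monoʳ-≤ _ z≤n) }
      excess (inj₂ (_ , _ , _ , _ , b)) = b
      open Balance (excess (balance linked p bound Post Pre Mid refl))
      outer : ∀ X → length (Pre ++ X ++ Post) ≡ z + (length X + z)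
      outer X = trans (length-++ Pre) (cong₂ _+_ |Pre| (trans (length-++ X) (cong (length X +_) |Post|)))
      |W| = outer blues
      |P| : length (Pre ++ Mid ++ Post) ≡ z + (length blues + length reds + z)
      |P| = trans (outer Mid) (cong (λ a → z + (a + z))
        (trans (↭-length (↭-sym partition)) (length-++ blues)))
      eq : ∀ z b r p D → (z + (b + r + z)) + 2 * z + (b + p + 1 + D) + 0 ≡ 2 * (z + (b + z)) + D + 1 + (r + p)
      eq = solve-∀

    suffix-blue : ∀ {V R′ z T} Q S → Linked R (Q ++ S) → (Q ++ S) ++ R′ ↭ V →
      PathsBounded (length (Q ++ S)) V → length S ≤ z → All (StartsPath z R′) T → Blue S T
    suffix-blue {V} {R′} Q S linked p bound S≤z starts =
      All-resp-↭ (↭-reverse S) (prefix-blue (reverse S)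
        (subst (Linked R) rev (linked-reverse linked))
        (↭-trans (++⁺ʳ R′ (↭-trans (↭-reflexive (sym rev)) (↭-reverse (Q ++ S)))) p)
        (subst (λ l → PathsBounded l V) (trans (sym (length-reverse (Q ++ S))) (cong length rev)) bound)
        (≤-trans (≤-reflexive (length-reverse S)) S≤z) starts)
      where
      rev = List.reverse-++ Q S

    middle-split : ∀ z (P : List A) → 2 * z ≤ length P →
      ∃ λ Pre → ∃₂ λ Mid Post → P ≡ Pre ++ Mid ++ Post × length Pre ≡ z × length Post ≡ z
    middle-split z P 2z≤ = take z P , take d rest , drop d rest ,
      sym (trans (cong (take z P ++_) (take++drop≡id d rest)) (take++drop≡id z P)) ,
      trans (length-take z P) (m≤n⇒m⊓n≡m (m+n≤o⇒m≤o z 2z≤)) ,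
      trans (List.length-drop d rest) (m∸[m∸n]≡n z≤rest)
      where
      rest = drop z P
      d    = length rest ∸ z
      z≤rest : z ≤ length rest
      z≤rest = ≤-trans (m+n≤o⇒m≤o∸n z (≤-trans (≤-reflexive (cong (z +_) (sym (+-identityʳ z)))) 2z≤))
        (≤-reflexive (sym (List.length-drop z P)))

    -- With z = 0 the ends `Pre` and `Post` are empty, so `blueOnLongestPath` applies to every T off
    -- the path.
    startsPath-0 : ∀ {V T} → T ⊑ V → All (StartsPath 0 V) T
    startsPath-0 T⊑V = All-splits _ λ where
      T₁ t T₂ refl → [] , [-] , ⊑-trans (T₁ ++ T₂ , ↭-sym (shift t T₁ T₂)) T⊑V , z≤n

    blueOnLongestPath : ∀ {V V′ P T} z → Linked R P → P ++ V′ ↭ V → PathsBounded (length P) V →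
      T ⊑ V′ → All (StartsPath z V′) T → 2 * z ≤ length P →
      ∃ λ W → W ⊑ P × Blue W T × length P + 2 * z ≤ 2 * length W + length T * pred (length T) + 1
    blueOnLongestPath {V′ = V′} {P} {T} z linked p bound (S , q) starts 2z≤ with middle-split z P 2z≤
    ... | Pre , Mid , Post , refl , |Pre| , |Post| =
      blueOnPath z Pre Mid Post linked (↭-trans (++⁺ˡ P q) p) bound |Pre| |Post|
        (prefix-blue Pre linked p bound (≤-reflexive |Pre|) starts)
        (suffix-blue (Pre ++ Mid) Post (subst (Linked R) assoc linked)
          (↭-trans (++⁺ʳ V′ (↭-reflexive (sym assoc))) p)
          (subst (λ P → PathsBounded (length P) _) assoc bound) (≤-reflexive |Post|) starts)
      where
      assoc = sym (List.++-assoc Pre Mid Post)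

    addPart : ∀ {m ms V W T} → BlueMultipartite ms T → W ++ T ⊑ V → Blue W T → m ≤ length W →
              HasBlueK (m ∷ ms) V
    addPart {V = V} {W} {T} K (S , p) blue m≤W with take-⊑ W m≤W
    ... | X , (Y , q) , |X| = X ++ T , part |X| (All-⊑ (Y , q) blue) K , Y ++ S ,
      ↭-trans (solve 4 (λ a b c d → (a ⊕ b) ⊕ (c ⊕ d) ⊜ ((a ⊕ c) ⊕ b) ⊕ d) ↭-refl X T Y S)
        (↭-trans (++⁺ʳ S (++⁺ʳ T q)) p)

    ⊑-disjoint : ∀ {W T P V′ V} → W ⊑ P → T ⊑ V′ → P ++ V′ ↭ V → W ++ T ⊑ V
    ⊑-disjoint {W} {T} (X , r) (S , q) p = X ++ S ,
      ↭-trans (solve 4 (λ a b c d → (a ⊕ b) ⊕ (c ⊕ d) ⊜ (a ⊕ c) ⊕ (b ⊕ d)) ↭-refl W T X S)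
        (↭-trans (++⁺ r q) p)

-- Inequalities between the sizes of paths, parts and remainders.

-- Adding the first two hypotheses gives l + (m + M) ≤ n, and the other c copies of l are at most c
-- n. Here and below n bounds all paths, l is the length of the longest path P, m is the largest
-- part, M the sum of the c + 1 others, D = M (M - 1), w counts vertices of P joined to T in blue,
-- and h, h′ are the halves of n - l.
short-path-bound : ∀ {n m M D l c r v} → 2 * (m + M) + D ≤ n → 2 * l ≤ n → l ≤ n →
  n * suc c + r ≤ v → suc c * l + (m + M) ≤ v
short-path-bound {n} {m} {M} {D} {l} {c} {r} {v} n-big 2l≤n l≤n v-big =
  by-slack r (+-mono-≤ (+-mono-≤ l+m+M≤n (*-monoʳ-≤ c l≤n)) v-big) (eq n m M l c r v)
  where
  l+m+M≤n : l + (m + M) ≤ n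
  l+m+M≤n = *-cancelˡ-≤ 2 (by-slack D (+-mono-≤ n-big 2l≤n) (eq₀ n m M D l))
    where
    eq₀ : ∀ n m M D l → 2 * (l + (m + M)) + (n + n) + D ≡ 2 * n + (2 * (m + M) + D + 2 * l)
    eq₀ = solve-∀
  eq : ∀ n m M l c r v → suc c * l + (m + M) + (n + c * n + v) + r ≡ v + (l + (m + M) + c * l + (n * suc c + r))
  eq = solve-∀

-- The term 2 M in the lower bound on n covers the deficit n - l.
long-path-bound : ∀ {n m M D l w} → 2 * (m + M) + D ≤ n → n ≤ l + 2 * M →
  l + 2 * 0 ≤ 2 * w + D + 1 → 2 * m ≤ 2 * w + 1
long-path-bound {n} {m} {M} {D} {l} {w} n-big n≤ W-big =
  by-slack 0 (+-mono-≤ (+-mono-≤ n-big n≤) W-big) (eq n m M D l w)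
  where
  eq : ∀ n m M D l w → 2 * m + (n + (l + 2 * M) + (2 * w + D + 1)) + 0
       ≡ 2 * w + 1 + (2 * (m + M) + D + n + (l + 2 * 0))
  eq = solve-∀

-- Removing P costs at most n vertices, the share of one part.
rest-bound : ∀ {n l c r v v′} → n * suc c + r ≤ v → v ≡ l + v′ → l ≤ n → n * c + r ≤ v′
rest-bound {n} {l} {c} {r} {v} {v′} v-big refl l≤n =
  by-slack 0 (+-mono-≤ v-big l≤n) (eq n l c r v′)
  where
  eq : ∀ n l c r v′ → n * c + r + (l + v′ + n) + 0 ≡ v′ + (n * suc c + r + l)
  eq = solve-∀

-- The gain 2 z = 2 (h + 1) - 2 M from the ends of P makes up for the deficit h + h′, up to the 2 M
-- available.
segment-bound : ∀ {l m M D h h′ w z} → 2 * (m + M) + D ≤ l + (h + h′) → h′ ≤ suc h → z + M ≡ suc h →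
  l + 2 * z ≤ 2 * w + D + 1 → 2 * m ≤ 2 * w + 1
segment-bound {l} {m} {M} {D} {h} {h′} {w} {z} n-big h′≤ z≡ W-big =
  by-slack 1 (+-mono-≤ (+-mono-≤ n-big h′≤) (+-mono-≤ W-big (*-monoʳ-≤ 2 (≤-reflexive (sym z≡)))))
    (eq l m M D h h′ w z)
  where
  eq : ∀ l m M D h h′ w z → 2 * m + (l + (h + h′) + suc h + (2 * w + D + 1 + 2 * (z + M))) + 1
       ≡ 2 * w + 1 + (2 * (m + M) + D + h′ + (l + 2 * z + 2 * suc h))
  eq = solve-∀

-- As M ≥ 1, the ends have 2 z ≤ 2 h ≤ h + h′ ≤ l vertices and do not overlap.
segments-fit : ∀ {l M h h′ z} → h ≤ h′ → h + h′ ≤ l → z + M ≡ suc h → 1 ≤ M → 2 * z ≤ l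
segments-fit {l} {M} {h} {h′} {z} h≤h′ fits z≡ M≥1 =
  by-slack 0 (+-mono-≤ (+-mono-≤ h≤h′ fits) (+-mono-≤ (*-monoʳ-≤ 2 (≤-reflexive z≡)) (*-monoʳ-≤ 2 M≥1)))
    (eq l M h h′ z)
  where
  eq : ∀ l M h h′ z → 2 * z + (h′ + l + (2 * suc h + 2 * M)) + 0 ≡ l + (h + (h + h′) + (2 * (z + M) + 2 * 1))
  eq = solve-∀

-- The remainder has at least (n - l) (c + 1) = (h + h′) (c + 1) vertices, and h′ = y + M.
remainder-bound : ∀ {n l h h′ c r v v′ x y M} → n ≡ l + (h + h′) → n * suc c + r ≤ v → v ≡ l + v′ →
  v′ + l ≤ x + suc c * l → y + M ≡ h′ → suc c * h + (y + M) ≤ x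
remainder-bound {_} {l} {h} {h′} {c} {r} {_} {v′} {x} refl v-big refl x-big refl =
  by-slack (r + c * h′) (+-mono-≤ v-big x-big) (eq l h h′ c r v′ x)
  where
  eq : ∀ l h h′ c r v′ x → suc c * h + h′ + (l + v′ + (x + suc c * l)) + (r + c * h′)
       ≡ x + ((l + (h + h′)) * suc c + r + (v′ + l))
  eq = solve-∀

-- The y = h′ - M vertices found off P play the part of the ends of P in `segment-bound`.
mixed-bound : ∀ {l m M D h h′ w y} → 2 * (m + M) + D ≤ l + (h + h′) → h ≤ h′ → y + M ≡ h′ →
  l + 2 * 0 ≤ 2 * w + D + 1 → 2 * m ≤ 2 * (w + y) + 1
mixed-bound {l} {m} {M} {D} {h} {_} {w} {y} n-big h≤h′ refl W-big =
  by-slack 0 (+-mono-≤ (+-mono-≤ n-big h≤h′) W-big) (eq l m M D h w y)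
  where
  eq : ∀ l m M D h w y → 2 * m + (l + (h + (y + M)) + (y + M) + (2 * w + D + 1)) + 0
       ≡ 2 * (w + y) + 1 + (2 * (m + M) + D + h + (l + 2 * 0))
  eq = solve-∀

tail-bound : ∀ {m m′ s n} → 2 * (m + (m′ + s)) + (m′ + s) * pred (m′ + s) ≤ n →
  2 * (m′ + s) + s * pred s ≤ n
tail-bound {m} {m′} {s} n-big = ≤-trans (+-mono-≤ (*-monoʳ-≤ 2 (m≤n+m (m′ + s) m))
  (*-mono-≤ (m≤n+m s m′) (pred-mono-≤ (m≤n+m s m′)))) n-big

⌈n/2⌉≤1+⌊n/2⌋ : ∀ n → ⌈ n /2⌉ ≤ suc ⌊ n /2⌋
⌈n/2⌉≤1+⌊n/2⌋ n = ⌊n/2⌋-mono (n≤1+n (suc n))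

double-≤⇒≤⌊/2⌋ : ∀ {a n} → 2 * a ≤ n → a ≤ ⌊ n /2⌋
double-≤⇒≤⌊/2⌋ {a} 2a≤n = ≤-trans (≤-reflexive (n≡⌊n+n/2⌋ a))
  (⌊n/2⌋-mono (≤-trans (≤-reflexive (cong (a +_) (sym (+-identityʳ a)))) 2a≤n))

-- Adding the largest part, and the induction on the number of parts.

module _ {A : Set} (R : A → A → Set) (R? : Decidable R) (R-sym : Symmetric R) where
  open Paths R R? R-sym

  module ExtendPath {n m : ℕ} {ms : List ℕ} {V P V′ : List A} (linked : Linked R P) (p : P ++ V′ ↭ V)
                    (longest : PathsBounded (length P) V) where

    M D l : ℕ
    M = sum ms
    D = M * pred M
    l = length P

    blueOnP : ∀ {T} z → BlueMultipartite ms T → T ⊑ V′ → All (StartsPath z V′) T → 2 * z ≤ l →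
      ∃ λ W → W ⊑ P × Blue W T × l + 2 * z ≤ 2 * length W + D + 1
    blueOnP z K T⊑V′ starts 2z≤l with blueOnLongestPath z linked p longest T⊑V′ starts 2z≤l
    ... | W , W⊑P , blue , big = W , W⊑P , blue ,
      subst (λ M → l + 2 * z ≤ 2 * length W + M * pred M + 1) (BlueMultipartite-length K) big

    joinPath : ∀ {T} z → BlueMultipartite ms T → T ⊑ V′ → All (StartsPath z V′) T → 2 * z ≤ l →
      (∀ w → l + 2 * z ≤ 2 * w + D + 1 → 2 * m ≤ 2 * w + 1) → HasBlueK (m ∷ ms) V
    joinPath z K T⊑V′ starts 2z≤l enough =
      let W , W⊑P , blue , big = blueOnP z K T⊑V′ starts 2z≤l
      in addPart K (⊑-disjoint W⊑P T⊑V′ p) blue (halve-≤ {m} {length W} (enough (length W) big))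

    -- The part U found off P and the set W on P are both joined to T in blue, and together they
    -- supply the part of size m; edges between U and W lie inside that part.
    joinPathAndPart : ∀ {y} → HasBlueK (y ∷ ms) V′ →
      (∀ w → l + 2 * 0 ≤ 2 * w + D + 1 → 2 * m ≤ 2 * (w + y) + 1) → HasBlueK (m ∷ ms) V
    joinPathAndPart {y} (_ , part {S = U} {T} |U| U-T K , UT⊑V′) enough =
      let T⊑V′ = ⊑-trans (rest-⊑ ↭-refl) UT⊑V′
          W , W⊑P , blue , big = blueOnP 0 K T⊑V′ (startsPath-0 T⊑V′) z≤n
      in addPart K (subst (_⊑ V) (sym (List.++-assoc W U T)) (⊑-disjoint W⊑P UT⊑V′ p)) (All.++⁺ blue U-T)
           (≤-trans (halve-≤ {m} {length W + y} (enough (length W) big))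
             (≤-reflexive (trans (cong (length W +_) (sym |U|)) (sym (length-++ W)))))

    module _ {c r : ℕ} (|ms| : length ms ≡ suc c) (M≥1 : 1 ≤ M) (n-big : 2 * (m + M) + D ≤ n)
             (V-big : n * suc c + r ≤ length V) where

      |V| : length V ≡ l + length V′
      |V| = trans (sym (↭-length p)) (length-++ P)

      shortPath : 2 * l ≤ n → l ≤ n → HasBlueK (m ∷ ms) V
      shortPath 2l≤n l≤n = dfs-HasBlueK m ms V longest
        (subst (λ k → k * l + (m + M) ≤ length V) (sym |ms|)
          (short-path-bound {n} {m} {M} {D} {l} {c} n-big 2l≤n l≤n V-big))

      -- Either T consists of initial segments, and z = h + 1 - M vertices at each end of P are
      -- joined to T in blue, or the remainder has no path with more than h vertices and yields T
      -- together with a part of size h′ - M.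
      mediumPath : ∀ h h′ → h ≤ h′ → h′ ≤ suc h → n ≡ l + (h + h′) → h + h′ ≤ l → M ≤ h →
                   HasBlueK (m ∷ ms) V
      mediumPath h h′ h≤h′ h′≤1+h refl e≤l M≤h =
        by-cases (initialSegments ms V′ M≤h (PathsBounded-⊑ (rest-⊑ p) longest))
        where
        by-cases : BlueKOfStarts ms h V′ ⊎ SmallRemainder ms l h V′ → HasBlueK (m ∷ ms) V
        by-cases (inj₁ (T , K , T⊑V′ , starts)) =
          joinPath (suc h ∸ M) K T⊑V′ (starts _ (≤-reflexive z+M≡))
            (segments-fit {l} {M} {h} {h′} h≤h′ e≤l z+M≡ M≥1)
            (λ w → segment-bound {l} {m} {M} {D} {h} {h′} {w} n-big h′≤1+h z+M≡)
          where
          z+M≡ : suc h ∸ M + M ≡ suc h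
          z+M≡ = m∸n+n≡m (m≤n⇒m≤1+n M≤h)
        by-cases (inj₂ (X , X⊑V′ , X-bound , X-big)) =
          joinPathAndPart (let T , K , T⊑X = large in T , K , ⊑-trans T⊑X X⊑V′)
            (λ w → mixed-bound {l} {m} {M} {D} {h} {h′} {w} n-big h≤h′ y+M≡)
          where
          y+M≡ : h′ ∸ M + M ≡ h′
          y+M≡ = m∸n+n≡m (≤-trans M≤h h≤h′)
          large : HasBlueK (h′ ∸ M ∷ ms) X
          large = dfs-HasBlueK (h′ ∸ M) ms X X-bound (subst (λ k → k * h + (h′ ∸ M + M) ≤ length X) (sym |ms|)
            (remainder-bound {n} {l} {h} {h′} {c} {r} {length V} {length V′} {length X} {h′ ∸ M} {M} refl V-big |V|
              (subst (λ k → length V′ + l ≤ length X + k * l) |ms| X-big) y+M≡))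

  -- Here n is the largest possible number of vertices of a red path, one less than in the theorem.
  -- The cases are 2 l ≤ n, then n - l ≤ 2 M, where T comes from the induction hypothesis off P, and
  -- finally the range in between.
  path-goodness : ∀ {n} m ms V → PathsBounded n V → All (1 ≤_) ms →
    2 * (m + sum ms) + sum ms * pred (sum ms) ≤ n →
    n * length ms + lastPart m ms ≤ length V → HasBlueK (m ∷ ms) V
  path-goodness {n} m [] V bound ms≥1 n-big V-big =
    dfs-HasBlueK m [] V bound (≤-trans (≤-reflexive (+-identityʳ m)) (≤-trans (m≤n+m m _) V-big))
  path-goodness {n} m ms@(m′ ∷ ms′) V bound (m′≥1 ∷ ms′≥1) n-big V-big with longestPath V
  ... | P , linked , (V′ , p) , longest = by-length (2 * length P ≤? n) (n ≤? length P + 2 * sum ms)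
    where
    l = length P
    e = n ∸ l
    l≤n : l ≤ n
    l≤n = bound linked (V′ , p)
    M≥1 : 1 ≤ sum ms
    M≥1 = ≤-trans m′≥1 (m≤m+n m′ (sum ms′))
    by-length : Dec (2 * l ≤ n) → Dec (n ≤ l + 2 * sum ms) → HasBlueK (m ∷ ms) V
    by-length (yes 2l≤n) _ = ExtendPath.shortPath linked p longest refl M≥1 n-big V-big 2l≤n l≤n
    by-length (no _) (yes n≤) =
      let T , K , T⊑V′ = path-goodness m′ ms′ V′ (PathsBounded-⊑ (rest-⊑ p) bound) ms′≥1
                           (tail-bound {m} {m′} {sum ms′} n-big)
                           (rest-bound {n} {l} {length ms′} V-big (trans (sym (↭-length p)) (length-++ P)) l≤n)
      in ExtendPath.joinPath {n} linked p longest 0 K T⊑V′ (startsPath-0 T⊑V′) z≤n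
           (λ w → long-path-bound {n} {m} {sum ms} {sum ms * pred (sum ms)} {l} {w} n-big n≤)
    by-length (no 2l≰n) (no n≰) =
      -- The halves of e satisfy h + h′ = e ≤ l because 2 l > n, and M ≤ h because e > 2 M.
      ExtendPath.mediumPath linked p longest refl M≥1 n-big V-big ⌊ e /2⌋ ⌈ e /2⌉
        (⌊n/2⌋≤⌈n/2⌉ e) (⌈n/2⌉≤1+⌊n/2⌋ e)
        (trans n≡ (cong (l +_) (sym halves)))
        (≤-trans (≤-reflexive halves) (+-cancelˡ-≤ l e l (≤-trans (≤-reflexive (sym n≡))
          (≤-trans (<⇒≤ (≰⇒> 2l≰n)) (≤-reflexive (cong (l +_) (+-identityʳ l)))))))
        (double-≤⇒≤⌊/2⌋ (+-cancelˡ-≤ l _ e (≤-trans (<⇒≤ (≰⇒> n≰)) (≤-reflexive n≡))))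
      where
      n≡ : n ≡ l + e
      n≡ = sym (m+[n∸m]≡n l≤n)
      halves : ⌊ e /2⌋ + ⌈ e /2⌉ ≡ e
      halves = ⌊n/2⌋+⌈n/2⌉≡n e

-- Paths and blue multipartite graphs in a coloured complete graph.

Unique-++⁻ : ∀ {A : Set} (xs : List A) {ys} → Unique (xs ++ ys) →
  Unique xs × Unique ys × All (λ x → All (x ≢_) ys) xs
Unique-++⁻ []       u        = [] , u , []
Unique-++⁻ (x ∷ xs) (x∉ ∷ u) with Unique-++⁻ xs u
... | u₁ , u₂ , apart = All.++⁻ˡ xs x∉ ∷ u₁ , u₂ , All.++⁻ʳ xs x∉ ∷ apart

Unique-⊑ : ∀ {A : Set} {Q V : List A} → Q ⊑ V → Unique V → Unique Q
Unique-⊑ {A} {Q} (_ , p) u =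
  proj₁ (Unique-++⁻ Q (Permutation.Unique-resp-↭ (setoid A) (↭⇒↭ₛ (↭-sym p)) u))

Linked-lookup : ∀ {A : Set} {R : A → A → Set} {Q} → Linked R Q → ∀ i j → toℕ j ≡ suc (toℕ i) →
  R (lookup Q i) (lookup Q j)
Linked-lookup (r ∷ _) zero    (suc zero) _ = r
Linked-lookup (_ ∷ l) (suc i) (suc j)    e = Linked-lookup l i j (suc-injective e)

-- Passes to parts in reverse order, the order of the induction.
reindex : ∀ {k} (m : Fin k → ℕ) → MPVertex m → MPVertex (m ∘ opposite)
reindex m (i , a) = opposite i , subst (Fin ∘ m) (sym (opposite-involutive i)) a

reindex-injective : ∀ {k} (m : Fin k → ℕ) → Injective _≡_ _≡_ (reindex m)
reindex-injective m {x} {y} eq = trans (sym (undo x)) (trans (cong back eq) (undo y))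
  where
  back : MPVertex (m ∘ opposite) → MPVertex m
  back (i , a) = opposite i , a
  transport : ∀ {i j} (eq : j ≡ i) a → (j , subst (Fin ∘ m) (sym eq) a) ≡ (i , a)
  transport refl a = refl
  undo : ∀ x → back (reindex m x) ≡ x
  undo (i , a) = transport (opposite-involutive i) a


module _ {N : ℕ} (c : EdgeColouring N) where

  Red : Fin N → Fin N → Set
  Red x y = col c x y ≡ red

  Red? : Decidable Red
  Red? x y = col c x y Bool.≟ red

  Red-sym : Symmetric Red
  Red-sym {x} {y} r = trans (symm c y x) r

  open Paths Red Red? Red-sym

  redPath : ∀ {n Q} → Linked Red Q → Q ⊑ allFin N → n ≤ length Q → HasRedPath c n
  redPath {Q = Q} linked Q⊑ n≤ =
    (λ i → lookup Q (inject≤ i n≤)) ,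
    (λ eq → inject≤-injective n≤ n≤ _ _ (Unique-lookup-injective (Unique-⊑ Q⊑ (allFin⁺ N)) eq)) ,
    λ i j e → Linked-lookup linked _ _
      (trans (toℕ-inject≤ j n≤) (trans e (cong suc (sym (toℕ-inject≤ i n≤)))))

  vertex : ∀ {k} {m : Fin k → ℕ} {T} → BlueMultipartite (tabulate m) T → MPVertex m → Fin N
  vertex {suc k} (part {S = S} |S| _ K) (zero  , a) = lookup S (cast (sym |S|) a)
  vertex {suc k} (part |S| _ K)         (suc i , a) = vertex K (i , a)

  -- Applied to the property of differing from, or not being red to, a fixed vertex of another part.
  vertex-All : ∀ {P : Fin N → Set} {k} {m : Fin k → ℕ} {T} (K : BlueMultipartite (tabulate m) T) →
    All P T → ∀ x → P (vertex K x)
  vertex-All {k = suc k} (part {S = S} _ _ K) ps (zero  , a) = All.lookup (All.++⁻ˡ S ps) (∈-lookup _)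
  vertex-All {k = suc k} (part {S = S} _ _ K) ps (suc i , a) = vertex-All K (All.++⁻ʳ S ps) (i , a)

  vertex-injective : ∀ {k} {m : Fin k → ℕ} {T} (K : BlueMultipartite (tabulate m) T) → Unique T →
    Injective _≡_ _≡_ (vertex K)
  vertex-injective {suc k} (part {S = S} |S| _ K) u {zero , a} {zero , b} eq =
    cong (zero ,_) (trans (sym (cast-involutive |S| (sym |S|) a)) (trans
      (cong (cast |S|) (Unique-lookup-injective (proj₁ (Unique-++⁻ S u)) eq)) (cast-involutive |S| (sym |S|) b)))
  vertex-injective {suc k} (part {S = S} _ _ K) u {zero , a} {suc j , b} eq =
    contradiction eq (vertex-All K (All.lookup (proj₂ (proj₂ (Unique-++⁻ S u))) (∈-lookup _)) (j , b))
  vertex-injective {suc k} (part {S = S} _ _ K) u {suc i , a} {zero , b} eq =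
    contradiction (sym eq) (vertex-All K (All.lookup (proj₂ (proj₂ (Unique-++⁻ S u))) (∈-lookup _)) (i , a))
  vertex-injective {suc k} (part {S = S} _ _ K) u {suc i , a} {suc j , b} eq
    with vertex-injective K (proj₁ (proj₂ (Unique-++⁻ S u))) {i , a} {j , b} eq
  ... | refl = refl

  vertex-blue : ∀ {k} {m : Fin k → ℕ} {T} (K : BlueMultipartite (tabulate m) T) i j a b → i ≢ j →
    ¬ Red (vertex K (i , a)) (vertex K (j , b))
  vertex-blue {suc k} _ zero zero a b i≢j = contradiction refl i≢j
  vertex-blue {suc k} (part _ blue K) zero (suc j) a b _ = vertex-All K (All.lookup blue (∈-lookup _)) (j , b)
  vertex-blue {suc k} (part _ blue K) (suc i) zero a b _ r =
    vertex-All K (All.lookup blue (∈-lookup _)) (i , a) (Red-sym r)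
  vertex-blue {suc k} (part _ _ K) (suc i) (suc j) a b i≢j = vertex-blue K i j a b (i≢j ∘ cong suc)

  blueMultipartite : ∀ {k} (m : Fin k → ℕ) → HasBlueK (tabulate (m ∘ opposite)) (allFin N) →
    HasBlueMultipartite c m
  blueMultipartite m (T , K , T⊑) =
    vertex K ∘ reindex m ,
    (λ eq → reindex-injective m (vertex-injective K (Unique-⊑ T⊑ (allFin⁺ N)) eq)) ,
    λ i j a b i≢j → Bool.¬-not (vertex-blue K (opposite i) (opposite j) _ _
      (λ eq → i≢j (trans (sym (opposite-involutive i)) (trans (cong opposite eq) (opposite-involutive j)))))

  redPathOrBounded : ∀ n → HasRedPath c n ⊎ PathsBounded (n ∸ 1) (allFin N)
  redPathOrBounded n with longestPath (allFin N)
  ... | Q , linked , Q⊑ , longest with n ≤? length Q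
  ...   | yes n≤ = inj₁ (redPath linked Q⊑ n≤)
  ...   | no n≰  = inj₂ (λ l ⊑ → ≤-trans (longest l ⊑) (pred-mono-≤ (≰⇒> n≰)))

-- Passing between rational and natural inequalities.

ℕtoℚ≡mkℚ : ∀ n → ℕtoℚ n ≡ mkℚ (ℤ.+ n) 0 (Coprime.sym (Coprime.1-coprimeTo n))
ℕtoℚ≡mkℚ n = ℚ.normalize-coprime (Coprime.sym (Coprime.1-coprimeTo n))

ℕtoℚ-cancel-< : ∀ {a b} → ℕtoℚ a ℚ.< ℕtoℚ b → a < b
ℕtoℚ-cancel-< {a} {b} lt with subst₂ ℚ._<_ (ℕtoℚ≡mkℚ a) (ℕtoℚ≡mkℚ b) lt
... | ℚ.*<* lt′ = ℤ.drop‿+<+ (subst₂ ℤ._<_ (ℤ.*-identityʳ (ℤ.+ a)) (ℤ.*-identityʳ (ℤ.+ b)) lt′)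

ℕtoℚ-mono-< : ∀ {a b} → a < b → ℕtoℚ a ℚ.< ℕtoℚ b
ℕtoℚ-mono-< {a} {b} a<b = subst₂ ℚ._<_ (sym (ℕtoℚ≡mkℚ a)) (sym (ℕtoℚ≡mkℚ b))
  (ℚ.*<* (subst₂ ℤ._<_ (sym (ℤ.*-identityʳ (ℤ.+ a))) (sym (ℤ.*-identityʳ (ℤ.+ b))) (ℤ.+<+ a<b)))

ℕtoℚ-cancel-≤ : ∀ {a b} → ℕtoℚ a ℚ.≤ ℕtoℚ b → a ≤ b
ℕtoℚ-cancel-≤ {a} {b} a≤b = ≮⇒≥ (λ b<a → ℚ.<-irrefl refl (ℚ.<-≤-trans (ℕtoℚ-mono-< b<a) a≤b))

ℕtoℚ-homo-+ : ∀ a b → ℕtoℚ (a + b) ≡ ℕtoℚ a ℚ.+ ℕtoℚ b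
ℕtoℚ-homo-+ a b rewrite ℕtoℚ≡mkℚ a | ℕtoℚ≡mkℚ b =
  cong (ℚ._/ 1) (cong₂ ℤ._+_ (sym (ℤ.*-identityʳ (ℤ.+ a))) (sym (ℤ.*-identityʳ (ℤ.+ b))))

ℕtoℚ-homo-* : ∀ a b → ℕtoℚ (a * b) ≡ ℕtoℚ a ℚ.* ℕtoℚ b
ℕtoℚ-homo-* a b rewrite ℕtoℚ≡mkℚ a | ℕtoℚ≡mkℚ b = cong (ℚ._/ 1) (ℤ.pos-* a b)

module _ {ε : ℚ} (ε>0 : 0ℚ ℚ.< ε) where

  ε*-mono-< : ∀ {a b} → a < b → ε ℚ.* ℕtoℚ a ℚ.< ε ℚ.* ℕtoℚ b
  ε*-mono-< a<b = ℚ.*-monoʳ-<-pos ε {{ℚ.positive ε>0}} (ℕtoℚ-mono-< a<b)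

  ε≤1⇒≤ : ε ℚ.≤ 1ℚ → ∀ {a b} → ℕtoℚ a ℚ.≤ ε ℚ.* ℕtoℚ b → a ≤ b
  ε≤1⇒≤ ε≤1 {a} {b} a≤εb = ℕtoℚ-cancel-≤ (ℚ.≤-trans a≤εb (ℚ.≤-trans
    (ℚ.*-monoʳ-≤-nonNeg (ℕtoℚ b) {{ℚ.normalize-nonNeg b 1}} ε≤1) (ℚ.≤-reflexive (ℚ.*-identityˡ (ℕtoℚ b)))))

  -- The summand ε s pays for the pairs counted by q. Strictness matters, as the bound is used with
  -- n - 1.
  surplus : ∀ {q s n} → ℕtoℚ q ℚ.< ε ℚ.* ℕtoℚ s → (ℕtoℚ 2 ℚ.+ ε) ℚ.* ℕtoℚ s ℚ.≤ ℕtoℚ n → 2 * s + q < n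
  surplus {q} {s} {n} q<εs n-big = ℕtoℚ-cancel-< (begin-strict
    ℕtoℚ (2 * s + q)                       ≡⟨ ℕtoℚ-homo-+ (2 * s) q ⟩
    ℕtoℚ (2 * s) ℚ.+ ℕtoℚ q                ≡⟨ cong (ℚ._+ ℕtoℚ q) (ℕtoℚ-homo-* 2 s) ⟩
    ℕtoℚ 2 ℚ.* ℕtoℚ s ℚ.+ ℕtoℚ q           <⟨ ℚ.+-monoʳ-< (ℕtoℚ 2 ℚ.* ℕtoℚ s) q<εs ⟩
    ℕtoℚ 2 ℚ.* ℕtoℚ s ℚ.+ ε ℚ.* ℕtoℚ s     ≡⟨ ℚ.*-distribʳ-+ (ℕtoℚ s) (ℕtoℚ 2) ε ⟨
    (ℕtoℚ 2 ℚ.+ ε) ℚ.* ℕtoℚ s              ≤⟨ n-big ⟩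
    ℕtoℚ n                                 ∎)
    where open ℚ.≤-Reasoning

-- Growth of the part sizes.

double-pred-≤ : ∀ {a b} → suc a ≤ 2 * b → 2 * a ≤ 2 * (b * b)
-- This is 2 b - 1 ≤ b * b doubled, with slack 2 (b - 1) * (b - 1).
double-pred-≤ {a} {suc x} a<2b = by-slack (2 * (x * x)) (*-monoʳ-≤ 2 a<2b) (eq a x)
  where
  eq : ∀ a x → 2 * a + 2 * (2 * suc x) + 2 * (x * x) ≡ 2 * (suc x * suc x) + 2 * suc a
  eq = solve-∀

-- The product expands to b * b + (2 s - 1) b + s (s - 1). The first hypothesis turns the last two
-- terms into at most 2 s b, and the second bounds this by b * b.
square-growth : ∀ {b s} → s * pred s ≤ b → 2 * s ≤ b → (b + s) * pred (b + s) ≤ 2 * (b * b)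
square-growth {b} {zero} _ _ rewrite +-identityʳ b =
  ≤-trans (*-monoʳ-≤ b (pred[n]≤n {b})) (m≤m+n (b * b) _)
square-growth {b} {suc y} sy≤b 2s≤b rewrite +-suc b y =
  by-slack 0 (+-mono-≤ sy≤b (*-monoʳ-≤ b 2s≤b)) (eq b y)
  where
  eq : ∀ b y → suc (b + y) * (b + y) + (b + b * b) + 0 ≡ 2 * (b * b) + (suc y * y + b * (2 * suc y))
  eq = solve-∀

-- Both bounds are carried along: for the sum s of the smaller parts, the largest being b, s < 2 b
-- gives 2 s ≤ 2 b * b ≤ b′, and with s (s - 1) ≤ b′ the next part b′ can be added by
-- `square-growth`.
growth : ∀ {k} (f : Fin (suc k) → ℕ) → (∀ i → 1 ≤ f i) →
  (∀ i j → toℕ j ≡ suc (toℕ i) → 2 * (f j * f j) ≤ f i) →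
  let s = sum (tabulate f); b = f zero in suc s ≤ 2 * b × s * pred s ≤ 2 * (b * b)
growth {zero} f pos _ =
  by-slack 0 (pos zero) (eq (f zero)) , square-growth {f zero} {0} z≤n z≤n
  where
  eq : ∀ b → suc (b + 0) + b + 0 ≡ 2 * b + 1
  eq = solve-∀
growth {suc k} f pos step with growth (f ∘ suc) (pos ∘ suc) (λ i j e → step (suc i) (suc j) (cong suc e))
... | s<2b , square = s<2b′ , square-growth (≤-trans square 2bb≤) (≤-trans (double-pred-≤ {b = b} s<2b) 2bb≤)
  where
  b  = f (suc zero)
  b′ = f zero
  2bb≤ : 2 * (b * b) ≤ b′
  2bb≤ = step zero (suc zero) refl
  b≤bb : 2 * b ≤ 2 * (b * b)
  b≤bb = *-monoʳ-≤ 2 (≤-trans (≤-reflexive (sym (*-identityʳ b))) (*-monoʳ-≤ b (pos (suc zero))))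
  s<2b′ : suc (b′ + sum (tabulate (f ∘ suc))) ≤ 2 * b′
  s<2b′ = by-slack 0 (≤-trans s<2b (≤-trans b≤bb 2bb≤)) (eq b′ (sum (tabulate (f ∘ suc))))
    where
    eq : ∀ b s → suc (b + s) + b + 0 ≡ 2 * b + suc s
    eq = solve-∀

-- Reversing the order of the parts.

sum-tabulate-last : ∀ k (f : Fin (suc k) → ℕ) →
  sum (tabulate f) ≡ f (fromℕ k) + sum (tabulate (f ∘ inject₁))
sum-tabulate-last zero    f = refl
sum-tabulate-last (suc k) f = trans (cong (f zero +_) (sum-tabulate-last k (f ∘ suc)))
  (eq (f zero) (f (suc (fromℕ k))) _)
  where
  eq : ∀ a b s → a + (b + s) ≡ b + (a + s)
  eq = solve-∀

sum-tabulate-opposite : ∀ {k} (f : Fin k → ℕ) → sum (tabulate (f ∘ opposite)) ≡ sum (tabulate f)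
sum-tabulate-opposite {zero}  f = refl
sum-tabulate-opposite {suc k} f = trans (cong (f (fromℕ k) +_) (sum-tabulate-opposite (f ∘ inject₁)))
  (sym (sum-tabulate-last k f))

lastPart-tabulate : ∀ k (f : Fin (suc k) → ℕ) → lastPart (f zero) (tabulate (f ∘ suc)) ≡ f (fromℕ k)
lastPart-tabulate zero    f = refl
lastPart-tabulate (suc k) f = lastPart-tabulate k (f ∘ suc)

opposite-anti : ∀ {k} {i j : Fin k} → toℕ j ≡ suc (toℕ i) → toℕ (opposite i) ≡ suc (toℕ (opposite j))
opposite-anti {k} {i} {j} e = trans (opposite-prop i)
  (trans (sym (trans (sym (+-∸-assoc 1 (toℕ<n j))) (cong (λ a → k ∸ a) e))) (cong suc (sym (opposite-prop j))))

-- s (s - 1) counts the ordered pairs (t, t′) of distinct vertices of the smaller parts.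
pairs-fit : ∀ {ε} → 0ℚ ℚ.< ε → ε ℚ.≤ 1ℚ → ∀ k (f : Fin (suc k) → ℕ) → (∀ i → 1 ≤ f i) →
  (∀ i j → toℕ j ≡ suc (toℕ i) → ℕtoℚ (2 * (f j * f j)) ℚ.≤ ε ℚ.* ℕtoℚ (f i)) →
  let s = sum (tabulate (f ∘ suc)) in ∃ λ q → s * pred s ≤ q × ℕtoℚ q ℚ.< ε ℚ.* ℕtoℚ (f zero + s)
pairs-fit {ε} ε>0 ε≤1 zero f pos step = 0 , z≤n ,
  subst (ℚ._< ε ℚ.* ℕtoℚ (f zero + 0)) (ℚ.*-zeroʳ ε)
    (ε*-mono-< ε>0 (≤-trans (pos zero) (m≤m+n (f zero) 0)))
pairs-fit ε>0 ε≤1 (suc k) f pos step =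
  -- The witness is q = 2 b * b for the second largest part b, which is at most ε times the largest
  -- part.
  _ , proj₂ (growth (f ∘ suc) (pos ∘ suc) (λ i j e → ε≤1⇒≤ ε>0 ε≤1 {2 * (f (suc j) * f (suc j))} (step (suc i) (suc j) (cong suc e)))) ,
  ℚ.≤-<-trans (step zero (suc zero) refl)
    (ε*-mono-< ε>0 (m<m+n (f zero) (≤-trans (pos (suc zero)) (m≤m+n _ _))))

theorem4 : (ε : ℚ) → 0ℚ ℚ.< ε → ε ℚ.≤ 1ℚ →
    (k : ℕ) (k≥1 : 1 ≤ k) (m : Fin k → ℕ) →
    (∀ i → 1 ≤ m i) →
    (∀ (i j : Fin k) → toℕ i ≤ toℕ j → m i ≤ m j) →
    (∀ (i j : Fin k) → toℕ j ≡ suc (toℕ i) →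
    ℕtoℚ (2 * (m i * m i)) ℚ.≤ ε ℚ.* ℕtoℚ (m j)) →
    (n N : ℕ) →
    (ℕtoℚ 2 ℚ.+ ε) ℚ.* ℕtoℚ (sumParts m) ℚ.≤ ℕtoℚ n →
    (n ∸ 1) * (k ∸ 1) + m (fromℕ< k≥1) ≤ N →
    Arrows N n m
theorem4 ε ε>0 ε≤1 (suc k) k≥1 m pos _ step n N n-big N-big c with redPathOrBounded c n
... | inj₁ found = inj₁ found
... | inj₂ bound = inj₂ (blueMultipartite c m
  (path-goodness (Red c) (Red? c) (Red-sym c) (f zero) (tabulate (f ∘ suc)) (allFin N) bound
    (All.tabulate⁺ (pos ∘ opposite ∘ suc)) n-fits N-fits))
  where
  f = m ∘ opposite
  s = sum (tabulate (f ∘ suc))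
  sum≡ : f zero + s ≡ sumParts m
  sum≡ = sum-tabulate-opposite m
  -- The strict inequality of `surplus` leaves room for the bound by n - 1.
  n-fits : 2 * (f zero + s) + s * pred s ≤ n ∸ 1
  n-fits with pairs-fit ε>0 ε≤1 k f (pos ∘ opposite) (λ i j e → step _ _ (opposite-anti e))
  ... | q , D≤q , q<ε = ≤-trans (+-monoʳ-≤ (2 * (f zero + s)) D≤q)
    (pred-mono-≤ (surplus ε>0 {q} {f zero + s} {n} q<ε (subst (λ s → (ℕtoℚ 2 ℚ.+ ε) ℚ.* ℕtoℚ s ℚ.≤ ℕtoℚ n) (sym sum≡) n-big)))
  N-fits : (n ∸ 1) * length (tabulate (f ∘ suc)) + lastPart (f zero) (tabulate (f ∘ suc)) ≤ length (allFin N)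
  N-fits = subst₂ _≤_
    (cong₂ (λ a b → (n ∸ 1) * a + b) (sym (length-tabulate (f ∘ suc)))
      (sym (trans (lastPart-tabulate k f) (cong m (opposite-involutive zero)))))
    (sym (length-tabulate (λ (i : Fin N) → i))) N-big
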